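{- Let $G$ be a finite graph such that $\max(\alpha_M(G),\omega_M(G))\geq 2$. Then $$p(G)\leq\lceil\log_2(\max(\alpha_M(G),\omega_M(G))+1)\rceil.$$
   Context: Graphs are finite, simple and undirected. For $W\subseteq V(G)$, $G[W]$ is the induced subgraph. A subset $M\subseteq V(G)$ is a module of $G$ if every $v\in V(G)\setminus M$ is adjacent either to all vertices of $M$ or to none of them; the modules $\emptyset$, $V(G)$ and the singletons are trivial. A graph $G$ is prime if $|V(G)|\geq 4$ and all its modules are trivial. An extension of $G$ is a graph $H$ with $V(H)\supseteq V(G)$ and $H[V(G)]=G$; a $p$-extension is an extension with $|V(H)\setminus V(G)|=p$. The prime bound $p(G)$ is the smallest integer $p\ge 0$ such that $G$ admits a prime $p$-extension (such extensions exist whenever $|V(G)|\ge 2$). The modular clique number $\omega_M(G)$ is the largest size of a module of $G$ that is a clique in $G$; the modular stability number $\alpha_M(G)$ is the largest size of a module of $G$ that is a stable set in $G$. -}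

module Defs where

open import Data.Nat using (ℕ; _+_; _≤_; _⊔_)
open import Data.Bool using (Bool; true; false)
open import Data.Fin using (Fin; _↑ˡ_)
open import Data.Fin.Subset using (Subset; _∈_; _∉_; ∣_∣; ⊥; ⁅_⁆; ⊤)
open import Data.Product using (Σ; _×_; _,_)
open import Data.Sum using (_⊎_)
open import Relation.Binary.PropositionalEquality using (_≡_; _≢_)

record Graph (n : ℕ) : Set where
  field
    adj   : Fin n → Fin n → Bool
    sym   : ∀ u v → adj u v ≡ adj v u
    irrefl : ∀ v → adj v v ≡ false
open Graph public

IsModule : ∀ {n} → Graph n → Subset n → Set
IsModule {n} G M = ∀ (v : Fin n) → v ∉ M →
  ((∀ u → u ∈ M → adj G v u ≡ true) ⊎ (∀ u → u ∈ M → adj G v u ≡ false))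

IsClique : ∀ {n} → Graph n → Subset n → Set
IsClique G M = ∀ u v → u ∈ M → v ∈ M → u ≢ v → adj G u v ≡ true

IsStable : ∀ {n} → Graph n → Subset n → Set
IsStable G M = ∀ u v → u ∈ M → v ∈ M → adj G u v ≡ false

IsTrivial : ∀ {n} → Subset n → Set
IsTrivial {n} M = (M ≡ ⊥) ⊎ (M ≡ ⊤) ⊎ Σ (Fin n) (λ v → M ≡ ⁅ v ⁆)

IsPrime : ∀ {n} → Graph n → Set
IsPrime {n} G = 4 ≤ n × (∀ M → IsModule G M → IsTrivial M)

IsExtension : ∀ {n p} → Graph n → Graph (n + p) → Set
IsExtension {n} {p} G H =
  ∀ (u v : Fin n) → adj H (u ↑ˡ p) (v ↑ˡ p) ≡ adj G u v

PrimeBoundAtMost : ∀ {n} → Graph n → ℕ → Set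
PrimeBoundAtMost {n} G b =
  Σ ℕ (λ p → p ≤ b × Σ (Graph (n + p)) (λ H → IsExtension G H × IsPrime H))

IsModularCliqueNumber : ∀ {n} → Graph n → ℕ → Set
IsModularCliqueNumber G k =
  Σ _ (λ M → IsModule G M × IsClique G M × ∣ M ∣ ≡ k)
  × (∀ M → IsModule G M → IsClique G M → ∣ M ∣ ≤ k)

IsModularStabilityNumber : ∀ {n} → Graph n → ℕ → Set
IsModularStabilityNumber G k =
  Σ _ (λ M → IsModule G M × IsStable G M × ∣ M ∣ ≡ k)
  × (∀ M → IsModule G M → IsStable G M → ∣ M ∣ ≤ k)

{-# OPTIONS --safe #-}

-- Twins (pairs {u, v} that are modules) form an equivalence relation whose classes are clique or stable modules,
-- so they have size at most m = max(α_M, ω_M).  Up to complementation some stable module T has size m.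
-- Fix t₀ ∈ T and let q = ⌈log₂ (m + 1)⌉, so that 2^(q-1) ≤ m < 2^q.  Add a clique x_0, …, x_{q-1} and give each
-- vertex v a set code(v) of neighbours among the x_i such that
--   (1) no module of G with at least two elements has a constant code,
--   (2) code(v) is not full if v is adjacent to t₀, and not empty otherwise,
--   (3) for each i some twin t_i of t₀ has code {x_i}.
-- For (1) it suffices to be injective on twin classes and, among vertices without twins, to mark those that are
-- the least element of a nontrivial module: inside an inclusion-minimal module without twins only the least
-- element is marked.  As (2) excludes one code per vertex, 2^q - 1 ≥ m codes remain.
-- Let N be a module of the extension with at least two elements.  If N contains some x_i together with another vertex, then
-- N contains all x_i and t_i, because otherwise N has an old vertex that distinguishes the twins t_i and t_j; then
-- (2) forces N to be everything.  If N contains no x_i, it is a module of G with constant code, against (1).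
module Submission where

open import Defs renaming (sym to adj-sym)
open import Data.Bool using (Bool; true; false; not; if_then_else_; _xor_)
import Data.Bool.Properties as Bool
open import Data.Fin using (Fin; zero; suc; toℕ; join; splitAt; _↑ˡ_; _≟_)
import Data.Fin as Fin
open import Data.Fin.Properties using (any?; all?; toℕ<n; splitAt-join; splitAt-↑ˡ; join-splitAt; ↑ˡ-injective)
import Data.Fin.Properties as Fin
open import Data.Fin.Subset using (Subset; inside; outside; _∈_; _∉_; _⊂_; _∩_; ∣_∣; ⁅_⁆)
open import Data.Fin.Subset.Properties using (_∈?_; anySubset?; nonempty?; Empty-unique; ⊆-antisym; ⊆⊤; x∈⁅x⁆; x∈⁅y⁆⇒x≡y; x∈p∩q⁺; x∈p∩q⁻; p∩q⊆p; p∩q⊆q; p⊆q⇒∣p∣≤∣q∣; ∣p∣≤n)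
open import Data.Fin.Subset.Induction using (⊂-wellFounded)
open import Data.Nat using (ℕ; zero; suc; _+_; _*_; _∸_; _^_; _≤_; _<_; _⊔_; ⌊_/2⌋; ⌈_/2⌉; z≤n; s≤s; z<s; s<s; s≤s⁻¹; s<s⁻¹)
open import Data.Nat.Properties hiding (_≟_)
open import Data.Nat.Logarithm using (⌈log₂_⌉; ⌈log₂⌉-mono-≤; ⌈log₂2^n⌉≡n)
open import Data.Nat.Logarithm.Core using (⌈log2⌉)
open import Data.Nat.Induction using (<-wellFounded)
open import Data.Product using (Σ; ∃; _×_; _,_; proj₁; proj₂)
open import Data.Sum using (_⊎_; inj₁; inj₂)
open import Data.Vec using (_∷_; here; there; tabulate)
open import Data.Vec.Properties using (lookup∘tabulate; []=⇒lookup; lookup⇒[]=)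
open import Function using (_∘_)
open import Induction.WellFounded using (Acc; acc)
open import Relation.Binary.PropositionalEquality using (_≡_; _≢_; refl; sym; trans; cong; cong₂; subst; module ≡-Reasoning)
open import Relation.Nullary using (¬_; yes; no; does; contradiction)
open import Relation.Nullary.Decidable using (_×-dec_; _→-dec_; ¬?; dec-true; dec-false; decidable-stable)
open import Relation.Unary using (Decidable)

-- Bounds for the rounded binary logarithm

n≤2^⌈log₂n⌉ : ∀ n → n ≤ 2 ^ ⌈log₂ n ⌉
n≤2^⌈log₂n⌉ n = go n (<-wellFounded n)
  where
  n≤2*⌈n/2⌉ : ∀ n → n ≤ 2 * ⌈ n /2⌉
  n≤2*⌈n/2⌉ n = begin
    n                       ≡⟨ ⌊n/2⌋+⌈n/2⌉≡n n ⟨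
    ⌊ n /2⌋ + ⌈ n /2⌉       ≤⟨ +-monoˡ-≤ _ (⌊n/2⌋≤⌈n/2⌉ n) ⟩
    ⌈ n /2⌉ + ⌈ n /2⌉       ≡⟨ cong (⌈ n /2⌉ +_) (+-identityʳ _) ⟨
    2 * ⌈ n /2⌉             ∎
    where open ≤-Reasoning

  -- The accessibility proof is arbitrary because `⌈log2⌉` recurses on it and the recursive call
  -- carries a different one.
  go : ∀ n (a : Acc _<_ n) → n ≤ 2 ^ ⌈log2⌉ n a
  go 0 _ = z≤n
  go 1 _ = ≤-refl
  go (suc (suc n)) (acc rs) =
    ≤-trans (n≤2*⌈n/2⌉ (suc (suc n))) (*-monoʳ-≤ 2 (go (suc ⌈ n /2⌉) _))

⌈log₂n⌉≡1+i⇒2^i<n : ∀ {i n} → ⌈log₂ n ⌉ ≡ suc i → 2 ^ i < n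
⌈log₂n⌉≡1+i⇒2^i<n {i} {n} eq = ≰⇒> λ n≤2^i →
  1+n≰n (subst (_≤ i) eq (subst (⌈log₂ n ⌉ ≤_) (⌈log₂2^n⌉≡n i) (⌈log₂⌉-mono-≤ n≤2^i)))

-- Binary digits

odd : ℕ → Bool
odd 0             = false
odd 1             = true
odd (suc (suc n)) = odd n

bit : ℕ → ℕ → Bool
bit zero    n = odd n
bit (suc i) n = bit i ⌊ n /2⌋

bit-0 : ∀ i → bit i 0 ≡ false
bit-0 zero    = refl
bit-0 (suc i) = bit-0 i

odd-half-injective : ∀ m n → odd m ≡ odd n → ⌊ m /2⌋ ≡ ⌊ n /2⌋ → m ≡ n
odd-half-injective 0             0             _ _ = refl
odd-half-injective 1             1             _ _ = refl
odd-half-injective 0             1             () _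
odd-half-injective 0             (suc (suc n)) _ ()
odd-half-injective (suc (suc m)) (suc (suc n)) p q =
  cong (λ k → suc (suc k)) (odd-half-injective m n p (suc-injective q))

⌊/2⌋-<-2* : ∀ n k → n < 2 * k → ⌊ n /2⌋ < k
⌊/2⌋-<-2* n             zero    ()
⌊/2⌋-<-2* 0             (suc k) _ = z<s
⌊/2⌋-<-2* 1             (suc k) _ = z<s
⌊/2⌋-<-2* (suc (suc n)) (suc k) p =
  s<s (⌊/2⌋-<-2* n k (s<s⁻¹ (subst (suc n <_) (+-suc k (k + 0)) (s<s⁻¹ p))))

-- Parity and half determine a number, and halving shifts the remaining digits down by one place.
bit-injective : ∀ q {m n} → m < 2 ^ q → n < 2 ^ q →
  (∀ (i : Fin q) → bit (toℕ i) m ≡ bit (toℕ i) n) → m ≡ n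
bit-injective zero    (s≤s z≤n) (s≤s z≤n) _ = refl
bit-injective (suc q) {m} {n} m< n< eq = odd-half-injective m n (eq zero)
  (bit-injective q (⌊/2⌋-<-2* m _ m<) (⌊/2⌋-<-2* n _ n<) (eq ∘ suc))

⌊2*n/2⌋≡n : ∀ n → ⌊ 2 * n /2⌋ ≡ n
⌊2*n/2⌋≡n n = sym (trans (n≡⌊n+n/2⌋ n) (cong (λ k → ⌊ n + k /2⌋) (sym (+-identityʳ n))))

odd-2* : ∀ n → odd (2 * n) ≡ false
odd-2* zero    = refl
odd-2* (suc n) = trans (cong (odd ∘ suc) (+-suc n (n + 0))) (odd-2* n)

bit-2^-same : ∀ i → bit i (2 ^ i) ≡ true
bit-2^-same zero    = refl
bit-2^-same (suc i) = trans (cong (bit i) (⌊2*n/2⌋≡n (2 ^ i))) (bit-2^-same i)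

bit-2^-other : ∀ i j → i ≢ j → bit j (2 ^ i) ≡ false
bit-2^-other zero    zero    i≢j = contradiction refl i≢j
bit-2^-other zero    (suc j) _   = bit-0 j
bit-2^-other (suc i) zero    _   = odd-2* (2 ^ i)
bit-2^-other (suc i) (suc j) i≢j =
  trans (cong (bit j) (⌊2*n/2⌋≡n (2 ^ i))) (bit-2^-other i j (i≢j ∘ cong suc))

-- Finite subsets

comprehension : ∀ {n} {P : Fin n → Set} → Decidable P → Subset n
comprehension P? = tabulate (does ∘ P?)

module _ {n : ℕ} {P : Fin n → Set} (P? : Decidable P) where

  ∈-comprehension⁺ : ∀ {x} → P x → x ∈ comprehension P?
  ∈-comprehension⁺ {x} px = lookup⇒[]= x _
    (trans (lookup∘tabulate (does ∘ P?) x) (dec-true (P? x) px))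

  ∈-comprehension⁻ : ∀ {x} → x ∈ comprehension P? → P x
  ∈-comprehension⁻ {x} x∈ = decidable-stable (P? x) λ ¬px →
    contradiction (trans (sym (trans (sym (lookup∘tabulate (does ∘ P?) x)) ([]=⇒lookup x∈))) (dec-false (P? x) ¬px)) λ ()

-- Numbers the elements of `S` from 0. Vertices outside `S` get a value too, so that no membership
-- proof is carried along.
rank : ∀ {n} → Subset n → Fin n → ℕ
rank (b       ∷ S) zero    = 0
rank (outside ∷ S) (suc x) = rank S x
rank (inside  ∷ S) (suc x) = suc (rank S x)

rank<∣∣ : ∀ {n} (S : Subset n) {x} → x ∈ S → rank S x < ∣ S ∣
rank<∣∣ (inside  ∷ S) here        = z<s
rank<∣∣ (outside ∷ S) (there x∈S) = rank<∣∣ S x∈S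
rank<∣∣ (inside  ∷ S) (there x∈S) = s<s (rank<∣∣ S x∈S)

rank-injective : ∀ {n} (S : Subset n) {x y} → x ∈ S → y ∈ S → rank S x ≡ rank S y → x ≡ y
rank-injective (inside  ∷ S) here        here        _  = refl
rank-injective (inside  ∷ S) (there x∈S) (there y∈S) eq = cong suc (rank-injective S x∈S y∈S (suc-injective eq))
rank-injective (outside ∷ S) (there x∈S) (there y∈S) eq = cong suc (rank-injective S x∈S y∈S eq)

rank-surjective : ∀ {n} (S : Subset n) {i} → i < ∣ S ∣ → ∃ λ x → x ∈ S × rank S x ≡ i
rank-surjective (outside ∷ S) i< with rank-surjective S i<
... | x , x∈S , eq = suc x , there x∈S , eq
rank-surjective (inside ∷ S) {zero}  _  = zero , here , refl
rank-surjective (inside ∷ S) {suc i} i< with rank-surjective S (s<s⁻¹ i<)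
... | x , x∈S , eq = suc x , there x∈S , cong suc eq

least : ∀ {n} (S : Subset n) {x} → x ∈ S → ∃ λ u → u ∈ S × (∀ w → w ∈ S → u Fin.≤ w)
least (inside  ∷ S) _           = zero , here , λ _ _ → z≤n
least (outside ∷ S) (there x∈S) with least S x∈S
... | u , u∈S , u≤ = suc u , there u∈S , λ { (suc w) (there w∈S) → s≤s (u≤ w w∈S) }

trivial-if-⊤ : ∀ {n} (M : Subset n) →
  (∀ {x y} → x ∈ M → y ∈ M → x ≢ y → ∀ z → z ∈ M) → IsTrivial M
trivial-if-⊤ M all with nonempty? M
... | no  ∄x        = inj₁ (Empty-unique ∄x)
... | yes (x , x∈M) with any? (λ y → (y ∈? M) ×-dec ¬? (y ≟ x))
...   | yes (y , y∈M , y≢x) = inj₂ (inj₁ (⊆-antisym ⊆⊤ (λ {z} _ → all y∈M x∈M y≢x z)))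
...   | no  ∄y              = inj₂ (inj₂ (x , ⊆-antisym
  (λ {y} y∈M → subst (_∈ ⁅ x ⁆) (sym (decidable-stable (y ≟ x) λ y≢x → ∄y (y , y∈M , y≢x))) (x∈⁅x⁆ x))
  (λ y∈ → subst (_∈ M) (sym (x∈⁅y⁆⇒x≡y x y∈)) x∈M)))

-- Modules and complements

-- An equational form of the module condition, easier to chain and to decide than the choice between
-- all and none.
Homogeneous : ∀ {n} → Graph n → Subset n → Set
Homogeneous G S = ∀ z x y → z ∉ S → x ∈ S → y ∈ S → adj G z x ≡ adj G z y

homogeneous? : ∀ {n} (G : Graph n) → Decidable (Homogeneous G)
homogeneous? G S = all? λ z → all? λ x → all? λ y →
  ¬? (z ∈? S) →-dec (x ∈? S) →-dec (y ∈? S) →-dec (adj G z x Bool.≟ adj G z y)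

module⇒homogeneous : ∀ {n} (G : Graph n) {S} → IsModule G S → Homogeneous G S
module⇒homogeneous G mod z x y z∉S x∈S y∈S with mod z z∉S
... | inj₁ all = trans (all x x∈S) (sym (all y y∈S))
... | inj₂ all = trans (all x x∈S) (sym (all y y∈S))

homogeneous⇒module : ∀ {n} (G : Graph n) {S} → Homogeneous G S → IsModule G S
homogeneous⇒module G {S} hom z z∉S with nonempty? S
... | no ∄x = inj₁ λ u u∈S → contradiction (u , u∈S) ∄x
... | yes (x , x∈S) with adj G z x in eq
...   | true  = inj₁ λ u u∈S → trans (hom z u x z∉S u∈S x∈S) eq
...   | false = inj₂ λ u u∈S → trans (hom z u x z∉S u∈S x∈S) eq

∁ᴳ : ∀ {n} → Graph n → Graph n
adj (∁ᴳ G) u v = if does (u ≟ v) then false else not (adj G u v)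
adj-sym (∁ᴳ G) u v with u ≟ v | v ≟ u
... | yes _    | yes _   = refl
... | yes refl | no v≢u  = contradiction refl v≢u
... | no u≢v   | yes refl = contradiction refl u≢v
... | no _     | no _    = cong not (adj-sym G u v)
irrefl (∁ᴳ G) v rewrite dec-true (v ≟ v) refl = refl

adj-∁ᴳ : ∀ {n} (G : Graph n) {u v} → u ≢ v → adj (∁ᴳ G) u v ≡ not (adj G u v)
adj-∁ᴳ G {u} {v} u≢v rewrite dec-false (u ≟ v) u≢v = refl

∉∈⇒≢ : ∀ {n} {S : Subset n} {x y} → x ∉ S → y ∈ S → x ≢ y
∉∈⇒≢ x∉S y∈S refl = x∉S y∈S

homogeneous-∁ᴳ⁺ : ∀ {n} (G : Graph n) {S} → Homogeneous G S → Homogeneous (∁ᴳ G) S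
homogeneous-∁ᴳ⁺ G hom z x y z∉S x∈S y∈S = begin
  adj (∁ᴳ G) z x ≡⟨ adj-∁ᴳ G (∉∈⇒≢ z∉S x∈S) ⟩
  not (adj G z x) ≡⟨ cong not (hom z x y z∉S x∈S y∈S) ⟩
  not (adj G z y) ≡⟨ adj-∁ᴳ G (∉∈⇒≢ z∉S y∈S) ⟨
  adj (∁ᴳ G) z y ∎
  where open ≡-Reasoning

homogeneous-∁ᴳ⁻ : ∀ {n} (G : Graph n) {S} → Homogeneous (∁ᴳ G) S → Homogeneous G S
homogeneous-∁ᴳ⁻ G hom z x y z∉S x∈S y∈S = Bool.not-injective (begin
  not (adj G z x) ≡⟨ adj-∁ᴳ G (∉∈⇒≢ z∉S x∈S) ⟨
  adj (∁ᴳ G) z x ≡⟨ hom z x y z∉S x∈S y∈S ⟩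
  adj (∁ᴳ G) z y ≡⟨ adj-∁ᴳ G (∉∈⇒≢ z∉S y∈S) ⟩
  not (adj G z y) ∎)
  where open ≡-Reasoning

prime-∁ᴳ : ∀ {n} (G : Graph n) → IsPrime G → IsPrime (∁ᴳ G)
prime-∁ᴳ G (4≤n , triv) = 4≤n , λ M mod →
  triv M (homogeneous⇒module G (homogeneous-∁ᴳ⁻ G (module⇒homogeneous (∁ᴳ G) mod)))

extension-∁ᴳ : ∀ {n p} (G : Graph n) (H : Graph (n + p)) → IsExtension (∁ᴳ G) H → IsExtension G (∁ᴳ H)
extension-∁ᴳ {n} {p} G H ext u v with u ≟ v
... | yes refl = trans (irrefl (∁ᴳ H) (u ↑ˡ p)) (sym (irrefl G u))
... | no  u≢v  = begin
  adj (∁ᴳ H) (u ↑ˡ p) (v ↑ˡ p)   ≡⟨ adj-∁ᴳ H (u≢v ∘ ↑ˡ-injective p u v) ⟩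
  not (adj H (u ↑ˡ p) (v ↑ˡ p))   ≡⟨ cong not (ext u v) ⟩
  not (adj (∁ᴳ G) u v)            ≡⟨ cong not (adj-∁ᴳ G u≢v) ⟩
  not (not (adj G u v))           ≡⟨ Bool.not-involutive _ ⟩
  adj G u v                       ∎
  where open ≡-Reasoning

clique-∁ᴳ : ∀ {n} (G : Graph n) {S} → IsClique G S → IsStable (∁ᴳ G) S
clique-∁ᴳ G cl u v u∈S v∈S with u ≟ v
... | yes _   = refl
... | no  u≢v = cong not (cl u v u∈S v∈S u≢v)

stable-∁ᴳ⁻ : ∀ {n} (G : Graph n) {S} → IsStable (∁ᴳ G) S → IsClique G S
stable-∁ᴳ⁻ G st u v u∈S v∈S u≢v =
  Bool.not-injective (trans (sym (adj-∁ᴳ G u≢v)) (st u v u∈S v∈S))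

clique-∁ᴳ⁻ : ∀ {n} (G : Graph n) {S} → IsClique (∁ᴳ G) S → IsStable G S
clique-∁ᴳ⁻ G cl u v u∈S v∈S with u ≟ v
... | yes refl = irrefl G u
... | no  u≢v  = Bool.not-injective (trans (sym (adj-∁ᴳ G u≢v)) (cl u v u∈S v∈S u≢v))

-- Twins

module _ {n : ℕ} (G : Graph n) where

  -- The adjacency between `u` and `v` is left free, which covers adjacent and nonadjacent twins
  -- alike.
  Twin : Fin n → Fin n → Set
  Twin u v = ∀ w → w ≢ u → w ≢ v → adj G w u ≡ adj G w v

  twin? : ∀ u → Decidable (Twin u)
  twin? u v = all? λ w → ¬? (w ≟ u) →-dec ¬? (w ≟ v) →-dec (adj G w u Bool.≟ adj G w v)

  twin-refl : ∀ {u} → Twin u u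
  twin-refl _ _ _ = refl

  twin-sym : ∀ {u v} → Twin u v → Twin v u
  twin-sym uv w w≢v w≢u = sym (uv w w≢u w≢v)

  twin-trans : ∀ {u v w} → Twin u v → Twin v w → Twin u w
  twin-trans {u} {v} {w} uv vw z z≢u z≢w with z ≟ v | u ≟ w
  ... | no z≢v   | _        = trans (uv z z≢u z≢v) (vw z z≢v z≢w)
  ... | yes refl | yes refl = refl
  -- Neither hypothesis speaks about the shared vertex `v`. The second moves the pair `u`, `v` to
  -- `u`, `w`, and the first moves that to `w`, `v`.
  ... | yes refl | no u≢w   = begin
    adj G v u ≡⟨ adj-sym G v u ⟩
    adj G u v ≡⟨ vw u (z≢u ∘ sym) u≢w ⟩
    adj G u w ≡⟨ adj-sym G u w ⟩
    adj G w u ≡⟨ uv w (u≢w ∘ sym) (z≢w ∘ sym) ⟩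
    adj G w v ≡⟨ adj-sym G w v ⟩
    adj G v w ∎
    where open ≡-Reasoning

  homogeneous-pair⇒twin : ∀ {S u v} → Homogeneous G S → u ∈ S → v ∈ S →
    (∀ w → w ∈ S → w ≢ u → w ≡ v) → Twin u v
  homogeneous-pair⇒twin {S} {u} {v} hom u∈S v∈S only w w≢u w≢v =
    hom w u v (λ w∈S → w≢v (only w w∈S w≢u)) u∈S v∈S

  stable⇒twin : ∀ {S u v} → Homogeneous G S → IsStable G S → u ∈ S → v ∈ S → Twin u v
  stable⇒twin {S} {u} {v} hom st u∈S v∈S w _ _ with w ∈? S
  ... | yes w∈S = trans (st w u w∈S u∈S) (sym (st w v w∈S v∈S))
  ... | no  w∉S = hom w u v w∉S u∈S v∈S

  twinClass : Fin n → Subset n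
  twinClass v = comprehension (twin? v)

  ∈-twinClass⁺ : ∀ {u v} → Twin u v → v ∈ twinClass u
  ∈-twinClass⁺ {u} = ∈-comprehension⁺ (twin? u)

  ∈-twinClass⁻ : ∀ {u v} → v ∈ twinClass u → Twin u v
  ∈-twinClass⁻ {u} = ∈-comprehension⁻ (twin? u)

  twinClass-cong : ∀ {u v} → Twin u v → twinClass u ≡ twinClass v
  twinClass-cong uv = ⊆-antisym
    (λ x∈ → ∈-twinClass⁺ (twin-trans (twin-sym uv) (∈-twinClass⁻ x∈)))
    (λ x∈ → ∈-twinClass⁺ (twin-trans uv (∈-twinClass⁻ x∈)))

  twinClass-homogeneous : ∀ v → Homogeneous G (twinClass v)
  twinClass-homogeneous v z x y z∉ x∈ y∈ =
    twin-trans (twin-sym (∈-twinClass⁻ x∈)) (∈-twinClass⁻ y∈) z (∉∈⇒≢ z∉ x∈) (∉∈⇒≢ z∉ y∈)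

  -- The ends of a pair can be exchanged for twins one at a time, passing through `v`. Hence a
  -- single adjacency value governs the whole class.
  twinClass-adj : ∀ {v w x y} → Twin v w → v ≢ w → Twin v x → Twin v y → x ≢ y → adj G x y ≡ adj G v w
  twinClass-adj {v} {w} {x} {y} vw v≢w vx vy x≢y with x ≟ v | y ≟ v
  ... | yes refl | _ = twin-trans (twin-sym vy) vw v x≢y v≢w
  ... | no x≢v | yes refl = trans (adj-sym G x v) (twin-trans (twin-sym vx) vw v (x≢v ∘ sym) v≢w)
  ... | no x≢v | no y≢v = begin
    adj G x y ≡⟨ twin-sym vy x x≢y x≢v ⟩
    adj G x v ≡⟨ adj-sym G x v ⟩
    adj G v x ≡⟨ twin-trans (twin-sym vx) vw v (x≢v ∘ sym) v≢w ⟩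
    adj G v w ∎
    where open ≡-Reasoning

  HasTwin : Fin n → Set
  HasTwin v = ∃ λ w → Twin v w × v ≢ w

  hasTwin? : Decidable HasTwin
  hasTwin? v = any? λ w → twin? v w ×-dec ¬? (v ≟ w)

  twinClass-stable⊎clique : ∀ v → IsStable G (twinClass v) ⊎ IsClique G (twinClass v)
  twinClass-stable⊎clique v with hasTwin? v
  ... | no ∄w = inj₁ λ x y x∈ y∈ →
    subst (λ z → adj G z y ≡ false) (only x x∈) (subst (λ z → adj G v z ≡ false) (only y y∈) (irrefl G v))
    where
    only : ∀ x → x ∈ twinClass v → v ≡ x
    only x x∈ = decidable-stable (v ≟ x) λ v≢x → ∄w (x , ∈-twinClass⁻ x∈ , v≢x)
  ... | yes (w , vw , v≢w) with adj G v w in eq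
  ...   | true  = inj₂ λ x y x∈ y∈ x≢y → trans (twinClass-adj vw v≢w (∈-twinClass⁻ x∈) (∈-twinClass⁻ y∈) x≢y) eq
  ...   | false = inj₁ stable
    where
    stable : IsStable G (twinClass v)
    stable x y x∈ y∈ with x ≟ y
    ... | yes refl = irrefl G x
    ... | no x≢y   = trans (twinClass-adj vw v≢w (∈-twinClass⁻ x∈) (∈-twinClass⁻ y∈) x≢y) eq

-- Separating the vertices of every module

  -- The set `S` may be all of `G`, since codes must separate the vertices of that module as well.
  LeastOf : Fin n → Subset n → Set
  LeastOf v S = Homogeneous G S × v ∈ S × (∀ u → u ∈ S → v Fin.≤ u) × ∃ λ u → u ∈ S × u ≢ v

  leads? : Decidable λ v → ∃ (LeastOf v)
  leads? v = anySubset? λ S → homogeneous? G S ×-dec (v ∈? S)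
    ×-dec all? (λ u → (u ∈? S) →-dec (v Fin.≤? u)) ×-dec any? (λ u → (u ∈? S) ×-dec ¬? (u ≟ v))

  -- Values recur in different twin classes. This is harmless, as only modules of `G` have to be
  -- separated, not all pairs of vertices.
  index : Fin n → ℕ
  index v with hasTwin? v | leads? v
  ... | yes _ | _     = rank (twinClass v) v
  ... | no _  | yes _ = 1
  ... | no _  | no _  = 0

  index-rank : ∀ {v} → HasTwin v → index v ≡ rank (twinClass v) v
  index-rank {v} tw with hasTwin? v | leads? v
  ... | yes _  | _ = refl
  ... | no ¬tw | _ = contradiction tw ¬tw

  index-leads : ∀ {v} → ¬ HasTwin v → ∃ (LeastOf v) → index v ≡ 1
  index-leads {v} ¬tw l with hasTwin? v | leads? v
  ... | yes tw | _     = contradiction tw ¬tw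
  ... | no _   | yes _ = refl
  ... | no _   | no ¬l = contradiction l ¬l

  index≡1⇒leads : ∀ {v} → ¬ HasTwin v → index v ≡ 1 → ∃ (LeastOf v)
  index≡1⇒leads {v} ¬tw eq with hasTwin? v | leads? v
  ... | yes tw | _     = contradiction tw ¬tw
  ... | no _   | yes l = l
  index≡1⇒leads {v} ¬tw () | no _ | no _

  -- Twins have the same class, so both indices are ranks in one subset.
  index-twins : ∀ {u v} → Twin u v → u ≢ v → index u ≢ index v
  index-twins {u} {v} uv u≢v eq = u≢v (rank-injective (twinClass v)
    (∈-twinClass⁺ (twin-sym uv)) (∈-twinClass⁺ twin-refl) (begin
      rank (twinClass v) u ≡⟨ cong (λ S → rank S u) (twinClass-cong uv) ⟨
      rank (twinClass u) u ≡⟨ index-rank (v , uv , u≢v) ⟨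
      index u              ≡⟨ eq ⟩
      index v              ≡⟨ index-rank (u , twin-sym uv , u≢v ∘ sym) ⟩
      rank (twinClass v) v ∎))
    where open ≡-Reasoning

  -- Ranks stay below the size of a stable or clique module, and `2 ≤ m` leaves room for the marks 0
  -- and 1.
  index< : ∀ {m} → 2 ≤ m → (∀ S → Homogeneous G S → IsStable G S ⊎ IsClique G S → ∣ S ∣ ≤ m) →
    ∀ v → index v < m
  index< 2≤m bound v with hasTwin? v | leads? v
  ... | yes _ | _     = <-≤-trans (rank<∣∣ (twinClass v) (∈-twinClass⁺ twin-refl))
                          (bound _ (twinClass-homogeneous v) (twinClass-stable⊎clique v))
  ... | no _  | yes _ = 2≤m
  ... | no _  | no _  = <⇒≤ 2≤m

  remove : Subset n → Fin n → Subset n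
  remove S v = comprehension λ x → (x ∈? S) ×-dec ¬? (x ≟ v)

  module _ {S : Subset n} {v : Fin n} where

    ∈-remove⁺ : ∀ {x} → x ∈ S → x ≢ v → x ∈ remove S v
    ∈-remove⁺ x∈S x≢v = ∈-comprehension⁺ (λ x → (x ∈? S) ×-dec ¬? (x ≟ v)) (x∈S , x≢v)

    ∈-remove⁻ : ∀ {x} → x ∈ remove S v → x ∈ S × x ≢ v
    ∈-remove⁻ = ∈-comprehension⁻ λ x → (x ∈? S) ×-dec ¬? (x ≟ v)

    remove-⊂ : v ∈ S → remove S v ⊂ S
    remove-⊂ v∈S = proj₁ ∘ ∈-remove⁻ , v , v∈S , λ v∈ → proj₂ (∈-remove⁻ v∈) refl

    -- The only vertex that becomes an outside vertex is `v` itself.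
    homogeneous-remove : Homogeneous G S →
      (∀ x y → x ∈ S → x ≢ v → y ∈ S → y ≢ v → adj G v x ≡ adj G v y) → Homogeneous G (remove S v)
    homogeneous-remove hom same z x y z∉ x∈ y∈ with z ≟ v | ∈-remove⁻ x∈ | ∈-remove⁻ y∈
    ... | yes refl | x∈S , x≢v | y∈S , y≢v = same x y x∈S x≢v y∈S y≢v
    ... | no z≢v | x∈S , _ | y∈S , _ = hom z x y (λ z∈S → z∉ (∈-remove⁺ z∈S z≢v)) x∈S y∈S

  homogeneous-∩ : ∀ {S S′} → Homogeneous G S → Homogeneous G S′ → Homogeneous G (S ∩ S′)
  homogeneous-∩ {S} {S′} hom hom′ z x y z∉ x∈ y∈ with z ∈? S | x∈p∩q⁻ S S′ x∈ | x∈p∩q⁻ S S′ y∈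
  ... | no z∉S  | x∈S , _ | y∈S , _ = hom z x y z∉S x∈S y∈S
  ... | yes z∈S | _ , x∈S′ | _ , y∈S′ = hom′ z x y (λ z∈S′ → z∉ (x∈p∩q⁺ (z∈S , z∈S′))) x∈S′ y∈S′

  -- The relation stands for equality of codes. It yields equal indices only under equal adjacency
  -- to `t₀`, because that adjacency enters the code.
  module _ (_~_ : Fin n → Fin n → Set) (t₀ : Fin n) (t₀-twin : HasTwin t₀)
    (t₀-nonadjacent : ∀ {v} → Twin t₀ v → adj G v t₀ ≡ false)
    (~⇒index≡ : ∀ {u v} → adj G u t₀ ≡ adj G v t₀ → u ~ v → index u ≡ index v)
    where

    -- Twins see `t₀` alike when both differ from it; if one of them is `t₀`, both values are false.
    twins≁ : ∀ {u v} → Twin u v → u ≢ v → ¬ u ~ v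
    twins≁ {u} {v} uv u≢v u~v = index-twins uv u≢v (~⇒index≡ same u~v)
      where
      same : adj G u t₀ ≡ adj G v t₀
      same with t₀ ≟ u | t₀ ≟ v
      ... | yes refl | _        = trans (irrefl G u) (sym (t₀-nonadjacent uv))
      ... | no _     | yes refl = trans (t₀-nonadjacent (twin-sym uv)) (sym (irrefl G v))
      ... | no t₀≢u  | no t₀≢v  = trans (adj-sym G u t₀) (trans (uv t₀ t₀≢u t₀≢v) (adj-sym G t₀ v))

    -- By induction on strict inclusion, `S` may be taken minimal among the homogeneous sets with
    -- two elements and constant code. Then its vertices have no twins and only its least vertex is
    -- marked, so the indices differ.
    homogeneous~⇒subsingleton : ∀ S → Acc _⊂_ S → Homogeneous G S →
      (∀ x y → x ∈ S → y ∈ S → x ~ y) → ∀ x y → x ∈ S → y ∈ S → x ≡ y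
    homogeneous~⇒subsingleton S (acc rs) hom const x y x∈S y∈S =
      decidable-stable (x ≟ y) impossible
      where
      subsingleton : ∀ {S′} → S′ ⊂ S → Homogeneous G S′ → ∀ x y → x ∈ S′ → y ∈ S′ → x ≡ y
      subsingleton S′⊂S hom′ = homogeneous~⇒subsingleton _ (rs S′⊂S) hom′
        λ x y x∈ y∈ → const x y (proj₁ S′⊂S x∈) (proj₁ S′⊂S y∈)

      -- Otherwise the rest of `S` is a single vertex by induction, and `S` is a pair of twins with
      -- equal codes.
      ¬homogeneous-remove : ∀ {v u} → v ∈ S → u ∈ S → v ≢ u → ¬ Homogeneous G (remove S v)
      ¬homogeneous-remove {v} {u} v∈S u∈S v≢u hom′ =
        twins≁ (homogeneous-pair⇒twin hom v∈S u∈S only) v≢u (const v u v∈S u∈S)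
        where
        only : ∀ w → w ∈ S → w ≢ v → w ≡ u
        only w w∈S w≢v = subsingleton (remove-⊂ v∈S) hom′ w u (∈-remove⁺ w∈S w≢v) (∈-remove⁺ u∈S (v≢u ∘ sym))

      -- A twin inside `S` would have a different code. A twin outside `S` sees `S` uniformly, so
      -- `v` sees the rest of `S` uniformly and could be removed.
      ¬hasTwin : ∀ {v u} → v ∈ S → u ∈ S → v ≢ u → ¬ HasTwin v
      ¬hasTwin {v} {u} v∈S u∈S v≢u (w , vw , v≢w) with w ∈? S
      ... | yes w∈S = twins≁ vw v≢w (const v w v∈S w∈S)
      ... | no  w∉S = ¬homogeneous-remove v∈S u∈S v≢u (homogeneous-remove hom same)
        where
        open ≡-Reasoning
        same : ∀ a b → a ∈ S → a ≢ v → b ∈ S → b ≢ v → adj G v a ≡ adj G v b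
        same a b a∈S a≢v b∈S b≢v = begin
          adj G v a ≡⟨ adj-sym G v a ⟩
          adj G a v ≡⟨ vw a a≢v (∉∈⇒≢ w∉S a∈S ∘ sym) ⟩
          adj G a w ≡⟨ adj-sym G a w ⟩
          adj G w a ≡⟨ hom w a b w∉S a∈S b∈S ⟩
          adj G w b ≡⟨ adj-sym G w b ⟩
          adj G b w ≡⟨ vw b b≢v (∉∈⇒≢ w∉S b∈S ∘ sym) ⟨
          adj G b v ≡⟨ adj-sym G b v ⟩
          adj G v b ∎

      -- Since v is least in S′, the smaller u is not in S′, so S and S′ overlap in v alone.
      ¬leads : ∀ {u v} → u ∈ S → v ∈ S → u Fin.≤ v → v ≢ u → ¬ ∃ (LeastOf v)
      ¬leads {u} {v} u∈S v∈S u≤v v≢u (S′ , hom′ , v∈S′ , v≤ , w , w∈S′ , w≢v) =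
        ¬homogeneous-remove v∈S u∈S v≢u (homogeneous-remove hom same)
        where
        open ≡-Reasoning
        u∉S′ : u ∉ S′
        u∉S′ u∈S′ = v≢u (Fin.≤-antisym (v≤ u u∈S′) u≤v)

        only : ∀ {a} → a ∈ S → a ≢ v → a ∉ S′
        only {a} a∈S a≢v a∈S′ = a≢v (subsingleton
          (p∩q⊆p S S′ , u , u∈S , u∉S′ ∘ p∩q⊆q S S′) (homogeneous-∩ hom hom′)
          a v (x∈p∩q⁺ (a∈S , a∈S′)) (x∈p∩q⁺ (v∈S , v∈S′)))

        w∉S : w ∉ S
        w∉S w∈S = only w∈S w≢v w∈S′

        same : ∀ a b → a ∈ S → a ≢ v → b ∈ S → b ≢ v → adj G v a ≡ adj G v b
        same a b a∈S a≢v b∈S b≢v = begin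
          adj G v a ≡⟨ adj-sym G v a ⟩
          adj G a v ≡⟨ hom′ a v w (only a∈S a≢v) v∈S′ w∈S′ ⟩
          adj G a w ≡⟨ adj-sym G a w ⟩
          adj G w a ≡⟨ hom w a b w∉S a∈S b∈S ⟩
          adj G w b ≡⟨ adj-sym G w b ⟩
          adj G b w ≡⟨ hom′ b v w (only b∈S b≢v) v∈S′ w∈S′ ⟨
          adj G b v ≡⟨ adj-sym G b v ⟩
          adj G v b ∎

      impossible : ¬ x ≢ y
      impossible x≢y with least S x∈S
      ... | u , u∈S , u≤ with other u
        where
        other : ∀ v → ∃ λ w → w ∈ S × w ≢ v
        other v with x ≟ v
        ... | yes refl = y , y∈S , x≢y ∘ sym
        ... | no x≢v   = x , x∈S , x≢v
      -- The set `S` itself shows that `u` is marked, so `v` is marked too. Both see `t₀` alike,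
      -- since `t₀` has a twin and hence lies outside `S`.
      ... | v , v∈S , v≢u = ¬leads u∈S v∈S (u≤ v v∈S) v≢u
        (index≡1⇒leads ¬twin-v (trans
          (~⇒index≡ (trans (adj-sym G v t₀) (trans (hom t₀ v u t₀∉S v∈S u∈S) (adj-sym G t₀ u)))
            (const v u v∈S u∈S))
          (index-leads ¬twin-u (S , hom , u∈S , u≤ , v , v∈S , v≢u))))
        where
        ¬twin-v : ¬ HasTwin v
        ¬twin-v = ¬hasTwin v∈S u∈S v≢u
        ¬twin-u : ¬ HasTwin u
        ¬twin-u = ¬hasTwin u∈S v∈S (v≢u ∘ sym)
        t₀∉S : t₀ ∉ S
        t₀∉S t₀∈S with t₀ ≟ u
        ... | yes refl = ¬twin-u t₀-twin
        ... | no t₀≢u  = ¬hasTwin t₀∈S u∈S t₀≢u t₀-twin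

-- The extension

-- The vertices t i and the new vertices form a prime core: a clique with one pendant vertex at each of its vertices.
module PrimeExtension {n : ℕ} (G : Graph n) (r : ℕ)
  (code : Fin n → Fin (2 + r) → Bool) (t₀ : Fin n) (t : Fin (2 + r) → Fin n)
  (t-twins : ∀ i j → Twin G (t i) (t j))
  (t-stable : ∀ i j → adj G (t i) (t j) ≡ false)
  (t₀-stable : ∀ i → adj G t₀ (t i) ≡ false)
  (code-t-same : ∀ i → code (t i) i ≡ true)
  (code-t-other : ∀ i j → i ≢ j → code (t i) j ≡ false)
  (code-proper : ∀ v → ¬ (∀ i → code v i ≡ adj G v t₀))
  (code-separates : ∀ S → Homogeneous G S → (∀ x y → x ∈ S → y ∈ S → ∀ i → code x i ≡ code y i) →
    ∀ x y → x ∈ S → y ∈ S → x ≡ y)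
  where

  q : ℕ
  q = 2 + r

  V : Set
  V = Fin n ⊎ Fin q

  adjⱽ : V → V → Bool
  adjⱽ (inj₁ u) (inj₁ v) = adj G u v
  adjⱽ (inj₁ u) (inj₂ i) = code u i
  adjⱽ (inj₂ i) (inj₁ u) = code u i
  adjⱽ (inj₂ i) (inj₂ j) = not (does (i ≟ j))

  adjⱽ-sym : ∀ x y → adjⱽ x y ≡ adjⱽ y x
  adjⱽ-sym (inj₁ u) (inj₁ v) = adj-sym G u v
  adjⱽ-sym (inj₁ u) (inj₂ i) = refl
  adjⱽ-sym (inj₂ i) (inj₁ u) = refl
  adjⱽ-sym (inj₂ i) (inj₂ j) with i ≟ j
  ... | yes refl = sym (cong not (dec-true (i ≟ i) refl))
  ... | no i≢j   = sym (cong not (dec-false (j ≟ i) (i≢j ∘ sym)))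

  adjⱽ-irrefl : ∀ x → adjⱽ x x ≡ false
  adjⱽ-irrefl (inj₁ u) = irrefl G u
  adjⱽ-irrefl (inj₂ i) = cong not (dec-true (i ≟ i) refl)

  H : Graph (n + q)
  adj H x y = adjⱽ (splitAt n x) (splitAt n y)
  adj-sym H x y = adjⱽ-sym (splitAt n x) (splitAt n y)
  irrefl H x = adjⱽ-irrefl (splitAt n x)

  extension : IsExtension G H
  extension u v = cong₂ adjⱽ (splitAt-↑ˡ n u q) (splitAt-↑ˡ n v q)

  -- Here the form `2 + r` of `q` matters: there are at least two new vertices.
  other : ∀ (i : Fin q) → ∃ λ j → i ≢ j
  other zero    = suc zero , λ ()
  other (suc i) = zero , λ ()

  module _ (M : Subset (n + q)) (hom : Homogeneous H M) where

    In : V → Set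
    In s = join n q s ∈ M

    in? : Decidable In
    in? s = join n q s ∈? M

    In-homogeneous : ∀ z x y → ¬ In z → In x → In y → adjⱽ z x ≡ adjⱽ z y
    In-homogeneous z x y z∉ x∈ y∈ = begin
      adjⱽ z x                           ≡⟨ cong₂ adjⱽ (splitAt-join n q z) (splitAt-join n q x) ⟨
      adj H (join n q z) (join n q x)    ≡⟨ hom _ _ _ z∉ x∈ y∈ ⟩
      adj H (join n q z) (join n q y)    ≡⟨ cong₂ adjⱽ (splitAt-join n q z) (splitAt-join n q y) ⟩
      adjⱽ z y                           ∎
      where open ≡-Reasoning

    distinguished : ∀ z x y → In x → In y → adjⱽ z x ≡ true → adjⱽ z y ≡ false → In z
    distinguished z x y x∈ y∈ zx zy = decidable-stable (in? z) λ z∉ →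
      contradiction (trans (sym zx) (trans (In-homogeneous z x y z∉ x∈ y∈) zy)) λ ()

    adjⱽ-new : ∀ {i j} → i ≢ j → adjⱽ (inj₂ i) (inj₂ j) ≡ true
    adjⱽ-new {i} {j} i≢j = cong not (dec-false (i ≟ j) i≢j)

    -- Membership spreads: `t i` distinguishes the two new vertices, and every other new vertex
    -- distinguishes `t i` from its neighbour. An old vertex left out would then have a constant
    -- code equal to its adjacency to `t₀`; this is applied to `t₀` first.
    two-new⇒all : ∀ {i j} → i ≢ j → In (inj₂ i) → In (inj₂ j) → ∀ z → In z
    two-new⇒all {i} {j} i≢j xi∈ xj∈ = all
      where
      ti∈ : In (inj₁ (t i))
      ti∈ = distinguished (inj₁ (t i)) (inj₂ i) (inj₂ j) xi∈ xj∈ (code-t-same i) (code-t-other i j i≢j)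

      new∈ : ∀ k → In (inj₂ k)
      new∈ k with k ≟ i
      ... | yes refl = xi∈
      ... | no k≢i   = distinguished (inj₂ k) (inj₂ i) (inj₁ (t i)) xi∈ ti∈
                         (adjⱽ-new k≢i) (code-t-other i k (k≢i ∘ sym))

      t₀∈ : In (inj₁ t₀)
      t₀∈ = decidable-stable (in? (inj₁ t₀)) λ t₀∉ → code-proper t₀ λ k →
        trans (In-homogeneous (inj₁ t₀) (inj₂ k) (inj₁ (t i)) t₀∉ (new∈ k) ti∈)
          (trans (t₀-stable i) (sym (irrefl G t₀)))

      all : ∀ z → In z
      all (inj₂ k) = new∈ k
      all (inj₁ v) = decidable-stable (in? (inj₁ v)) λ v∉ → code-proper v λ k →
        In-homogeneous (inj₁ v) (inj₂ k) (inj₁ t₀) v∉ (new∈ k) t₀∈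

    new-and-own⇒all : ∀ {i} → In (inj₂ i) → In (inj₁ (t i)) → ∀ z → In z
    new-and-own⇒all {i} xi∈ ti∈ with other i
    ... | k , i≢k = two-new⇒all i≢k xi∈
      (distinguished (inj₂ k) (inj₂ i) (inj₁ (t i)) xi∈ ti∈ (adjⱽ-new (i≢k ∘ sym)) (code-t-other i k i≢k))

    new-and-old⇒all : ∀ {i v} → In (inj₂ i) → In (inj₁ v) → ∀ z → In z
    new-and-old⇒all {i} {v} xi∈ v∈ with in? (inj₁ (t i))
    ... | yes ti∈ = new-and-own⇒all xi∈ ti∈
    ... | no ti∉ with other i
    ...   | j , i≢j with in? (inj₁ (t j))
    -- The vertex `t i` is adjacent to the new vertex `i` but not to `t j`.
    ...     | yes tj∈ = new-and-own⇒all xi∈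
      (distinguished (inj₁ (t i)) (inj₂ i) (inj₁ (t j)) xi∈ tj∈ (code-t-same i) (t-stable i j))
    -- Here t i and t j are twins of G, but x i distinguishes them and so must v.
    ...     | no tj∉ = contradiction (begin
      true          ≡⟨ code-t-same i ⟨
      code (t i) i  ≡⟨ In-homogeneous (inj₁ (t i)) (inj₂ i) (inj₁ v) ti∉ xi∈ v∈ ⟩
      adj G (t i) v ≡⟨ adj-sym G (t i) v ⟩
      adj G v (t i) ≡⟨ t-twins i j v (λ { refl → ti∉ v∈ }) (λ { refl → tj∉ v∈ }) ⟩
      adj G v (t j) ≡⟨ adj-sym G v (t j) ⟩
      adj G (t j) v ≡⟨ In-homogeneous (inj₁ (t j)) (inj₂ i) (inj₁ v) tj∉ xi∈ v∈ ⟨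
      code (t j) i  ≡⟨ code-t-other j i (i≢j ∘ sym) ⟩
      false         ∎) λ ()
      where open ≡-Reasoning

    -- All new vertices lie outside and see the members alike, so the old part is homogeneous in `G`
    -- with constant code.
    old⇒≡ : (∀ i → ¬ In (inj₂ i)) → ∀ u v → In (inj₁ u) → In (inj₁ v) → u ≡ v
    old⇒≡ new∉ u v u∈ v∈ = code-separates S
      (λ z x y z∉ x∈ y∈ → In-homogeneous (inj₁ z) (inj₁ x) (inj₁ y) (z∉ ∘ ∈-comprehension⁺ old?)
        (∈-comprehension⁻ old? x∈) (∈-comprehension⁻ old? y∈))
      (λ x y x∈ y∈ i → In-homogeneous (inj₂ i) (inj₁ x) (inj₁ y) (new∉ i)
        (∈-comprehension⁻ old? x∈) (∈-comprehension⁻ old? y∈))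
      u v (∈-comprehension⁺ old? u∈) (∈-comprehension⁺ old? v∈)
      where
      old? : Decidable (λ x → In (inj₁ x))
      old? x = in? (inj₁ x)
      S : Subset n
      S = comprehension old?

    two⇒all : ∀ x y → In x → In y → x ≢ y → ∀ z → In z
    two⇒all (inj₂ i) (inj₂ j) x∈ y∈ x≢y = two-new⇒all (x≢y ∘ cong inj₂) x∈ y∈
    two⇒all (inj₂ i) (inj₁ v) x∈ y∈ x≢y = new-and-old⇒all x∈ y∈
    two⇒all (inj₁ u) (inj₂ j) x∈ y∈ x≢y = new-and-old⇒all y∈ x∈
    two⇒all (inj₁ u) (inj₁ v) x∈ y∈ x≢y with any? (λ i → in? (inj₂ i))
    ... | yes (i , xi∈) = new-and-old⇒all xi∈ x∈
    ... | no  ∄i        = contradiction (cong inj₁ (old⇒≡ (λ i xi∈ → ∄i (i , xi∈)) u v x∈ y∈)) x≢y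

    trivial : IsTrivial M
    trivial = trivial-if-⊤ M λ {x} {y} x∈ y∈ x≢y z →
      subst (_∈ M) (join-splitAt n q z)
        (two⇒all (splitAt n x) (splitAt n y)
          (subst (_∈ M) (sym (join-splitAt n q x)) x∈) (subst (_∈ M) (sym (join-splitAt n q y)) y∈)
          (λ eq → x≢y (trans (sym (join-splitAt n q x)) (trans (cong (join n q) eq) (join-splitAt n q y))))
          (splitAt n z))

-- Prime extensions from a largest stable or clique module

PrimeExtensionBy : ∀ {n} → Graph n → ℕ → Set
PrimeExtensionBy {n} G p = Σ (Graph (n + p)) λ H → IsExtension G H × IsPrime H

primeExtension-∁ᴳ : ∀ {n p} (G : Graph n) → PrimeExtensionBy (∁ᴳ G) p → PrimeExtensionBy G p
primeExtension-∁ᴳ G (H , ext , prime) = ∁ᴳ H , extension-∁ᴳ G H ext , prime-∁ᴳ H prime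

xor-injectiveʳ : ∀ a {b c} → a xor b ≡ a xor c → b ≡ c
xor-injectiveʳ true  eq = Bool.not-injective eq
xor-injectiveʳ false eq = eq

module StableCase {n : ℕ} (G : Graph n) (m r : ℕ)
  (bound : ∀ S → Homogeneous G S → IsStable G S ⊎ IsClique G S → ∣ S ∣ ≤ m)
  (T : Subset n) (T-homogeneous : Homogeneous G T) (T-stable : IsStable G T) (∣T∣≡m : ∣ T ∣ ≡ m)
  (2≤m : 2 ≤ m) (m<2^q : m < 2 ^ (2 + r)) (2^q/2≤m : 2 ^ (1 + r) ≤ m)
  where

  q : ℕ
  q = 2 + r

  T-element : ∀ i → i < m → ∃ λ x → x ∈ T × rank T x ≡ i
  T-element i i<m = rank-surjective T (subst (i <_) (sym ∣T∣≡m) i<m)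

  t₀ t₁ : Fin n
  t₀ = proj₁ (T-element 0 (<⇒≤ 2≤m))
  t₁ = proj₁ (T-element 1 2≤m)

  t₀∈T : t₀ ∈ T
  t₀∈T = proj₁ (proj₂ (T-element 0 (<⇒≤ 2≤m)))

  t₁∈T : t₁ ∈ T
  t₁∈T = proj₁ (proj₂ (T-element 1 2≤m))

  t₀≢t₁ : t₀ ≢ t₁
  t₀≢t₁ eq = 0≢1+n (trans (sym (proj₂ (proj₂ (T-element 0 (<⇒≤ 2≤m)))))
    (trans (cong (rank T) eq) (proj₂ (proj₂ (T-element 1 2≤m)))))

  t₀t₁-twins : Twin G t₀ t₁
  t₀t₁-twins = stable⇒twin G T-homogeneous T-stable t₀∈T t₁∈T

  twin-has-twin : ∀ {v} → Twin G t₀ v → HasTwin G v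
  twin-has-twin {v} tv with v ≟ t₀
  ... | yes refl = t₁ , t₀t₁-twins , t₀≢t₁
  ... | no v≢t₀  = t₀ , twin-sym G tv , v≢t₀

  -- The common adjacency value of the class is that of `t₀` and `t₁`, which lie in the stable set
  -- `T`.
  class-stable : ∀ {x y} → Twin G t₀ x → Twin G t₀ y → adj G x y ≡ false
  class-stable {x} {y} tx ty with x ≟ y
  ... | yes refl = irrefl G x
  ... | no x≢y   = trans (twinClass-adj G t₀t₁-twins t₀≢t₁ tx ty x≢y) (T-stable t₀ t₁ t₀∈T t₁∈T)

  -- The xor makes the code of v differ from the constant adj G v t₀, as index v + 1 has a nonzero digit.
  code : Fin n → Fin q → Bool
  code v i = adj G v t₀ xor bit (toℕ i) (suc (index G v))

  index-code< : ∀ v → suc (index G v) < 2 ^ q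
  index-code< v = ≤-<-trans (index< G 2≤m bound v) m<2^q

  code-proper : ∀ v → ¬ (∀ i → code v i ≡ adj G v t₀)
  code-proper v eq = 1+n≢0 (bit-injective q (index-code< v) (<-≤-trans z<s (index-code< v)) λ i →
    trans (xor-injectiveʳ (adj G v t₀) (trans (eq i) (sym (Bool.xor-identityʳ _)))) (sym (bit-0 (toℕ i))))

  code⇒index : ∀ {u v} → adj G u t₀ ≡ adj G v t₀ → (∀ i → code u i ≡ code v i) → index G u ≡ index G v
  code⇒index {u} {v} same eq = suc-injective (bit-injective q (index-code< u) (index-code< v) λ i →
    xor-injectiveʳ (adj G u t₀) (trans (eq i) (cong (_xor bit (toℕ i) (suc (index G v))) (sym same))))

  -- Codes use the index plus one, so rank `2 ^ toℕ i ∸ 1` gives a number whose only nonzero digit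
  -- is digit `i`. The class contains `T`, which is large enough because `2 ^ (1 + r) ≤ m`.
  t-exists : ∀ (i : Fin q) → ∃ λ x → x ∈ twinClass G t₀ × rank (twinClass G t₀) x ≡ 2 ^ toℕ i ∸ 1
  t-exists i = rank-surjective (twinClass G t₀) (begin-strict
    2 ^ toℕ i ∸ 1      <⟨ ∸-monoʳ-< z<s (m^n>0 2 (toℕ i)) ⟩
    2 ^ toℕ i          ≤⟨ ^-monoʳ-≤ 2 (s≤s⁻¹ (toℕ<n i)) ⟩
    2 ^ (1 + r)        ≤⟨ 2^q/2≤m ⟩
    m                  ≡⟨ ∣T∣≡m ⟨
    ∣ T ∣              ≤⟨ p⊆q⇒∣p∣≤∣q∣ (∈-twinClass⁺ G ∘ stable⇒twin G T-homogeneous T-stable t₀∈T) ⟩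
    ∣ twinClass G t₀ ∣ ∎)
    where open ≤-Reasoning

  t : Fin q → Fin n
  t i = proj₁ (t-exists i)

  t₀t-twins : ∀ i → Twin G t₀ (t i)
  t₀t-twins i = ∈-twinClass⁻ G (proj₁ (proj₂ (t-exists i)))

  index-t : ∀ i → suc (index G (t i)) ≡ 2 ^ toℕ i
  index-t i = begin
    suc (index G (t i))                  ≡⟨ cong suc (index-rank G (twin-has-twin (t₀t-twins i))) ⟩
    suc (rank (twinClass G (t i)) (t i)) ≡⟨ cong (λ S → suc (rank S (t i))) (twinClass-cong G (t₀t-twins i)) ⟨
    suc (rank (twinClass G t₀) (t i))    ≡⟨ cong suc (proj₂ (proj₂ (t-exists i))) ⟩
    suc (2 ^ toℕ i ∸ 1)                  ≡⟨ m+[n∸m]≡n (m^n>0 2 (toℕ i)) ⟩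
    2 ^ toℕ i                            ∎
    where open ≡-Reasoning

  code-t : ∀ i j → code (t i) j ≡ bit (toℕ j) (2 ^ toℕ i)
  code-t i j = cong₂ (λ b k → b xor bit (toℕ j) k) (class-stable (t₀t-twins i) (twin-refl G)) (index-t i)

  open PrimeExtension G r code t₀ t
    (λ i j → twin-trans G (twin-sym G (t₀t-twins i)) (t₀t-twins j))
    (λ i j → class-stable (t₀t-twins i) (t₀t-twins j))
    (λ i → class-stable (twin-refl G) (t₀t-twins i))
    (λ i → trans (code-t i i) (bit-2^-same (toℕ i)))
    (λ i j i≢j → trans (code-t i j) (bit-2^-other (toℕ i) (toℕ j) (i≢j ∘ Fin.toℕ-injective)))
    code-proper
    (λ S → homogeneous~⇒subsingleton G (λ u v → ∀ i → code u i ≡ code v i) t₀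
      (t₁ , t₀t₁-twins , t₀≢t₁) (λ tv → class-stable tv (twin-refl G)) code⇒index S (⊂-wellFounded S))
    using (H; extension; trivial)

  primeExtension : PrimeExtensionBy G q
  primeExtension = H , extension ,
    -- At least two old vertices come from `T`, and at least two vertices are new.
    +-mono-≤ (≤-trans 2≤m (subst (_≤ n) ∣T∣≡m (∣p∣≤n T))) (s≤s (s≤s z≤n)) ,
    λ M mod → trivial M (module⇒homogeneous H mod)

theorem2 : ∀ {n : ℕ} (G : Graph n) (a w : ℕ) →
    IsModularStabilityNumber G a → IsModularCliqueNumber G w →
    2 ≤ a ⊔ w →
    PrimeBoundAtMost G ⌈log₂ (a ⊔ w + 1) ⌉
theorem2 {n} G a w ((A , A-mod , A-stable , ∣A∣≡a) , a-max) ((W , W-mod , W-clique , ∣W∣≡w) , w-max) 2≤m =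
  ⌈log₂ (m + 1) ⌉ , ≤-refl , subst (PrimeExtensionBy G) (sym log≡) (extend (⊔-sel a w))
  where
  m r : ℕ
  m = a ⊔ w
  r = ⌈log₂ (m + 1) ⌉ ∸ 2

  -- As `m + 1` is at least 3, its rounded logarithm is at least 2, so the truncated subtraction in
  -- `r` is exact.
  log≡ : ⌈log₂ (m + 1) ⌉ ≡ 2 + r
  log≡ = sym (m+[n∸m]≡n (⌈log₂⌉-mono-≤ (+-monoˡ-≤ 1 2≤m)))

  m<2^q : m < 2 ^ (2 + r)
  m<2^q = subst (λ k → m < 2 ^ k) log≡ (subst (_≤ 2 ^ ⌈log₂ (m + 1) ⌉) (+-comm m 1) (n≤2^⌈log₂n⌉ (m + 1)))

  2^q/2≤m : 2 ^ (1 + r) ≤ m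
  2^q/2≤m = s≤s⁻¹ (subst (2 ^ (1 + r) <_) (+-comm m 1) (⌈log₂n⌉≡1+i⇒2^i<n log≡))

  stable-bound : ∀ {S} → Homogeneous G S → IsStable G S → ∣ S ∣ ≤ m
  stable-bound hom st = ≤-trans (a-max _ (homogeneous⇒module G hom) st) (m≤m⊔n a w)

  clique-bound : ∀ {S} → Homogeneous G S → IsClique G S → ∣ S ∣ ≤ m
  clique-bound hom cl = ≤-trans (w-max _ (homogeneous⇒module G hom) cl) (m≤n⊔m a w)

  bound : ∀ S → Homogeneous G S → IsStable G S ⊎ IsClique G S → ∣ S ∣ ≤ m
  bound S hom (inj₁ st) = stable-bound hom st
  bound S hom (inj₂ cl) = clique-bound hom cl

  bound-∁ᴳ : ∀ S → Homogeneous (∁ᴳ G) S → IsStable (∁ᴳ G) S ⊎ IsClique (∁ᴳ G) S → ∣ S ∣ ≤ m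
  bound-∁ᴳ S hom (inj₁ st) = clique-bound (homogeneous-∁ᴳ⁻ G hom) (stable-∁ᴳ⁻ G st)
  bound-∁ᴳ S hom (inj₂ cl) = stable-bound (homogeneous-∁ᴳ⁻ G hom) (clique-∁ᴳ⁻ G cl)

  -- A largest clique module is a stable module of the complement, and complementing a prime
  -- extension found there gives one of `G`.
  extend : m ≡ a ⊎ m ≡ w → PrimeExtensionBy G (2 + r)
  extend (inj₁ m≡a) = StableCase.primeExtension G m r bound A
    (module⇒homogeneous G A-mod) A-stable (trans ∣A∣≡a (sym m≡a)) 2≤m m<2^q 2^q/2≤m
  extend (inj₂ m≡w) = primeExtension-∁ᴳ G (StableCase.primeExtension (∁ᴳ G) m r bound-∁ᴳ W
    (homogeneous-∁ᴳ⁺ G (module⇒homogeneous G W-mod)) (clique-∁ᴳ G W-clique)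
    (trans ∣W∣≡w (sym m≡w)) 2≤m m<2^q 2^q/2≤m)
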